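{- Every distance-hereditary graph is path-extremal. Equivalently, if $G$ is a distance-hereditary graph on $n$ vertices, then $\mathcal{Z}(G;x)\preceq \mathcal{Z}(P_n;x)$, i.e. $z(G;k)\le z(P_n;k)$ for every $k$.
   Context: All graphs are finite, simple and undirected; $P_n$ is the path on $n$ vertices. Zero forcing: given $S\subseteq V(G)$, color $S$ blue and the other vertices white. If a blue vertex has exactly one white neighbor, it forces that neighbor to become blue. Apply this rule repeatedly until no further force is possible. $S$ is a zero forcing set if all vertices end up blue. $z(G;k)$ is the number of zero forcing sets of $G$ of size $k$. The zero forcing polynomial of an $n$-vertex graph is $\mathcal{Z}(G;x)=\sum_{k=1}^n z(G;k)x^k$. For polynomials, $f\preceq g$ means that each coefficient of $f$ is at most the corresponding coefficient of $g$. A graph $G$ on $n$ vertices is path-extremal if $z(G;k)\le z(P_n;k)$ for all $0\le k\le n$. A graph is distance-hereditary if it can be obtained from the one-vertex graph $K_1$ by a sequence of the following operations, each adding a new vertex $u$ to the current graph $G$ at a vertex $v\in V(G)$: pendant addition ($u$ is adjacent exactly to $v$); false-twin addition ($u$ is not adjacent to $v$, and the neighborhood of $u$ is $N_G(v)$); true-twin addition ($u$ is adjacent to $v$, and the remaining neighbors of $u$ are exactly $N_G(v)$). -}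

module Defs where

open import Data.Empty using (⊥)
open import Data.Fin.Base using (Fin; zero; suc; toℕ)
import Data.Fin.Properties as Fin
open import Data.Fin.Subset using (Subset; inside; outside; ⊤; ⁅_⁆; _∈_; _∉_; _⊆_; _⊃_; _∪_; ∣_∣)
open import Data.Fin.Subset.Induction using (⊃-wellFounded)
open import Data.Fin.Subset.Properties
  using (_∈?_; ⊆⊤; ⊆-antisym; x∈⁅x⁆; x∈⁅y⁆⇒x≡y; x∈p∪q⁺; x∈p∪q⁻; p⊆p∪q)
import Data.Bool.Properties as Bool
open import Data.List.Base using (List; []; _∷_; _++_; map; filter; length; applyUpTo)
open import Data.Nat.Base using (ℕ; zero; suc; _≤_)
import Data.Nat.Properties as ℕ
open import Data.Product.Base using (∃-syntax; _×_; _,_)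
open import Data.Sum.Base using (_⊎_; inj₁; inj₂)
open import Data.Vec.Base using ([]; _∷_)
import Data.Vec.Properties as Vec
open import Function.Bundles using (_↔_; _⇔_; Inverse)
open import Induction.WellFounded using (Acc; acc)
open import Level using (0ℓ)
open import Relation.Binary.Construct.Closure.ReflexiveTransitive using (Star; ε; _◅_)
open import Relation.Binary.Core using (Rel)
open import Relation.Binary.Definitions using (Symmetric; Decidable)
open import Relation.Binary.PropositionalEquality.Core using (_≡_; refl; sym; subst)
open import Relation.Nullary.Decidable using (Dec; yes; no; map′; ¬?; _×-dec_; _⊎-dec_; _→-dec_)
open import Relation.Nullary.Negation using (¬_)
open import Relation.Unary using (Pred)
import Relation.Unary as U

record Graph (n : ℕ) : Set₁ where
  infix 4 _~_ _~?_
  field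
    _~_    : Rel (Fin n) 0ℓ
    _~?_   : Decidable _~_
    ~-sym  : Symmetric _~_
    ~-irr  : ∀ {v} → ¬ (v ~ v)

infix 4 _≅_

record _≅_ {n : ℕ} (G H : Graph n) : Set where
  private
    module G = Graph G
    module H = Graph H
  field
    vertices : Fin n ↔ Fin n
  open Inverse vertices public using (to; from)
  field
    adjacent : ∀ u v → (u G.~ v) ⇔ (to u H.~ to v)

K₁ : Graph 1
K₁ = record
  { _~_   = λ _ _ → ⊥
  ; _~?_  = λ _ _ → no λ ()
  ; ~-sym = λ ()
  ; ~-irr = λ ()
  }

Path : ∀ n → Graph n
Path n = record
  { _~_   = λ i j → suc (toℕ i) ≡ toℕ j ⊎ suc (toℕ j) ≡ toℕ i
  ; _~?_  = λ i j → (suc (toℕ i) ℕ.≟ toℕ j) ⊎-dec (suc (toℕ j) ℕ.≟ toℕ i)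
  ; ~-sym = λ { (inj₁ p) → inj₂ p ; (inj₂ p) → inj₁ p }
  ; ~-irr = λ { (inj₁ p) → ℕ.1+n≢n p ; (inj₂ p) → ℕ.1+n≢n p }
  }

-- The new vertex is zero, with neighbourhood N; an old vertex v becomes suc v.
module _ {n : ℕ} (G : Graph n) {N : Pred (Fin n) 0ℓ} (N? : U.Decidable N) where
  open Graph G

  private
    Adj : Rel (Fin (suc n)) 0ℓ
    Adj zero    zero    = ⊥
    Adj zero    (suc v) = N v
    Adj (suc u) zero    = N u
    Adj (suc u) (suc v) = u ~ v

    adj? : Decidable Adj
    adj? zero    zero    = no λ ()
    adj? zero    (suc v) = N? v
    adj? (suc u) zero    = N? u
    adj? (suc u) (suc v) = u ~? v

    adj-sym : Symmetric Adj
    adj-sym {zero}  {suc v} p = p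
    adj-sym {suc u} {zero}  p = p
    adj-sym {suc u} {suc v} p = ~-sym p

    adj-irr : ∀ {v} → ¬ Adj v v
    adj-irr {suc v} p = ~-irr p

  addVertex : Graph (suc n)
  addVertex = record
    { _~_   = Adj
    ; _~?_  = adj?
    ; ~-sym = λ {u} {v} → adj-sym {u} {v}
    ; ~-irr = λ {v} → adj-irr {v}
    }

module _ {n : ℕ} (G : Graph n) (v : Fin n) where
  open Graph G

  addPendant : Graph (suc n)
  addPendant = addVertex G (Fin._≟ v)

  addFalseTwin : Graph (suc n)
  addFalseTwin = addVertex G (v ~?_)

  addTrueTwin : Graph (suc n)
  addTrueTwin = addVertex G (λ w → (w Fin.≟ v) ⊎-dec (v ~? w))

data Construction : ∀ {n} → Graph n → Set₁ where
  single    : Construction K₁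
  pendant   : ∀ {n} {G : Graph n} → Construction G → ∀ v → Construction (addPendant G v)
  falseTwin : ∀ {n} {G : Graph n} → Construction G → ∀ v → Construction (addFalseTwin G v)
  trueTwin  : ∀ {n} {G : Graph n} → Construction G → ∀ v → Construction (addTrueTwin G v)

-- A construction fixes an order on the vertices, hence the closure under isomorphism.
DistanceHereditary : ∀ {n} → Graph n → Set₁
DistanceHereditary {n} H = ∃[ G ] Construction {n} G × G ≅ H

-- In the following, a subset of the vertices is the set of blue vertices.
module _ {n : ℕ} (G : Graph n) where
  open Graph G

  Forces : Subset n → Fin n → Fin n → Set
  Forces B v w = v ∈ B × w ∉ B × v ~ w × (∀ u → v ~ u → u ∉ B → u ≡ w)

  data Step (B : Subset n) : Subset n → Set where
    force : ∀ {v w} → Forces B v w → Step B (B ∪ ⁅ w ⁆)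

  -- No force is possible from ⊤, so a run reaching it is complete.  The order
  -- in which forces are applied is irrelevant, by zeroForcing-mono below.
  ZeroForcing : Subset n → Set
  ZeroForcing S = Star Step S ⊤

  forces? : ∀ B v w → Dec (Forces B v w)
  forces? B v w = (v ∈? B) ×-dec ¬? (w ∈? B) ×-dec (v ~? w) ×-dec
    Fin.all? (λ u → (v ~? u) →-dec (¬? (u ∈? B) →-dec (u Fin.≟ w)))

  zeroForcing-mono : ∀ {S T} → S ⊆ T → ZeroForcing S → ZeroForcing T
  zeroForcing-mono {T = T} S⊆T ε = subst ZeroForcing (⊆-antisym S⊆T ⊆⊤) ε
  zeroForcing-mono {S} {T} S⊆T (force {v} {w} (v∈S , w∉S , v~w , uniq) ◅ run)
    with w ∈? T
  ... | yes w∈T = zeroForcing-mono S∪w⊆T run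
    where
    S∪w⊆T : S ∪ ⁅ w ⁆ ⊆ T
    S∪w⊆T x∈ with x∈p∪q⁻ S ⁅ w ⁆ x∈
    ... | inj₁ x∈S = S⊆T x∈S
    ... | inj₂ x∈w = subst (_∈ T) (sym (x∈⁅y⁆⇒x≡y w x∈w)) w∈T
  ... | no  w∉T =
    force (S⊆T v∈S , w∉T , v~w , λ u v~u u∉T → uniq u v~u (λ u∈S → u∉T (S⊆T u∈S)))
      ◅ zeroForcing-mono S∪w⊆T∪w run
    where
    S∪w⊆T∪w : S ∪ ⁅ w ⁆ ⊆ T ∪ ⁅ w ⁆
    S∪w⊆T∪w x∈ with x∈p∪q⁻ S ⁅ w ⁆ x∈
    ... | inj₁ x∈S = x∈p∪q⁺ (inj₁ (S⊆T x∈S))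
    ... | inj₂ x∈w = x∈p∪q⁺ (inj₂ x∈w)

  private
    decide : ∀ S → Acc _⊃_ S → Dec (ZeroForcing S)
    decide S (acc rec) with Fin.any? (λ v → Fin.any? (forces? S v))
    ... | yes (v , w , f@(_ , w∉S , _)) =
      map′ (force f ◅_) (zeroForcing-mono (p⊆p∪q ⁅ w ⁆))
        (decide (S ∪ ⁅ w ⁆)
          (rec (p⊆p∪q ⁅ w ⁆ , w , x∈p∪q⁺ (inj₂ (x∈⁅x⁆ w)) , w∉S)))
    ... | no stuck with Vec.≡-dec Bool._≟_ S ⊤
    ...   | yes refl = yes ε
    ...   | no  S≢⊤  = no λ
      { ε             → S≢⊤ refl
      ; (force f ◅ _) → stuck (_ , _ , f)
      }

  zeroForcing? : U.Decidable ZeroForcing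
  zeroForcing? S = decide S (⊃-wellFounded S)

subsets : ∀ n → List (Subset n)
subsets zero    = [] ∷ []
subsets (suc n) = map (outside ∷_) (subsets n) ++ map (inside ∷_) (subsets n)

z : ∀ {n} → Graph n → ℕ → ℕ
z {n} G k = length (filter (λ S → (∣ S ∣ ℕ.≟ k) ×-dec zeroForcing? G S) (subsets n))

-- Coefficients in order of increasing degree, starting with the constant term.
Polynomial : Set
Polynomial = List ℕ

coeff : Polynomial → ℕ → ℕ
coeff []      _       = 0
coeff (a ∷ p) zero    = a
coeff (a ∷ p) (suc k) = coeff p k

infix 4 _⪯_

_⪯_ : Rel Polynomial 0ℓ
p ⪯ q = ∀ k → coeff p k ≤ coeff q k

-- The sum starts at k = 1, so the constant term is 0.
𝒵 : ∀ {n} → Graph n → Polynomial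
𝒵 {n} G = 0 ∷ applyUpTo (λ i → z G (suc i)) n

PathExtremal : ∀ {n} → Graph n → Set
PathExtremal {n} G = ∀ k → k ≤ n → z G k ≤ z (Path n) k

{-# OPTIONS --safe --termination-depth=2 #-}

-- A set S is not zero forcing iff it avoids some fort: a nonempty W such that
-- no vertex outside W has exactly one neighbour in W.  As zero forcing and
-- failing sets together are all sets, the theorem says that G has at least as
-- many failing sets of each size as the path.  Write F(G; k) for their number.
-- On the path, F(P_{n+2}; k) ≤ F(P_{n+1}; k) + F(P_n; k-1), whence also
-- F(P_{n+1}; k) ≤ C(n, k) and F(P_{n+2}; k) ≤ C(n, k).
-- Every induced subgraph of a distance-hereditary graph has an isolated vertex,
-- a leaf or a pair of twins.  An isolated vertex, as well as a pair of twins, is a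
-- fort, and all sets avoiding it fail: the two binomial bounds suffice.  If u is
-- a leaf at v, then F(G; k) ≥ F(G - u; k) + F(G - u - v; k-1), so that induction
-- applies.
module Submission where

open import Defs
open import Algebra.Properties.CommutativeSemigroup using (interchange; xy∙z≈xz∙y)
open import Data.Empty using (⊥; ⊥-elim)
open import Data.Fin.Base using (Fin; zero; suc; toℕ; punchIn; punchOut; inject₁)
import Data.Fin.Base as Fin
open import Data.Fin.Induction using (<-wellFounded)
import Data.Fin.Properties as Fin
open import Data.Fin.Subset using (Subset; Side; inside; outside; ⁅_⁆; _∈_; _∉_; _⊆_; _⊃_; _∪_; ∣_∣)
open import Data.Fin.Subset.Induction using (⊃-wellFounded)
open import Data.Fin.Subset.Properties
  using (_∈?_; ∈⊤; ⊆⊤; ⊆-antisym; x∈⁅x⁆; x∈⁅y⁆⇒x≡y; x∈p∪q⁺; x∈p∪q⁻; p⊆p∪q)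
open import Data.List.Base using ([]; _∷_; _++_; map; filter; length; applyUpTo)
open import Data.List.Properties using (filter-++; length-++)
import Data.List.Relation.Binary.Sublist.Propositional as Sublist
import Data.List.Relation.Binary.Sublist.Setoid.Properties as Sublist
open import Data.Nat.Base using (ℕ; zero; suc; _+_; _≤_; z≤n; s≤s)
import Data.Nat.Properties as ℕ
open import Data.Product.Base using (∃-syntax; _×_; _,_; proj₁; proj₂)
open import Data.Sum.Base using (_⊎_; inj₁; inj₂)
open import Data.Unit.Base using (⊤; tt)
open import Data.Vec.Base using ([]; _∷_; insertAt; here; there)
open import Data.Vec.Properties using (insertAt-lookup; insertAt-punchIn; lookup⇒[]=; []=⇒lookup)
open import Function.Base using (_∘_; id; _$_)
open import Function.Bundles using (_⇔_; Equivalence; Inverse; mk⇔)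
open import Function.Construct.Composition using (_⇔-∘_)
open import Function.Construct.Symmetry using (⇔-sym)
open import Induction.WellFounded using (Acc; acc)
open import Level using (0ℓ)
open import Relation.Binary.Construct.Closure.ReflexiveTransitive using (ε; _◅_)
open import Relation.Binary.PropositionalEquality
  using (_≡_; _≢_; refl; sym; trans; cong; cong₂; subst; subst₂; setoid; module ≡-Reasoning)
open import Relation.Nullary.Decidable
  using (yes; no; ¬?; _×-dec_; decidable-stable)
open import Relation.Nullary.Negation using (¬_)
open import Relation.Unary using (Pred)
import Relation.Unary as U

private
  variable
    m n : ℕ
    K : Pred ℕ 0ℓ

-- Vertices and subsets around a distinguished vertex

data Around (i : Fin (suc n)) : Fin (suc n) → Set where
  here  : Around i i
  there : ∀ j → Around i (punchIn i j)

around : ∀ (i j : Fin (suc n)) → Around i j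
around i j with i Fin.≟ j
... | yes refl = here
... | no  i≢j  = subst (Around i) (Fin.punchIn-punchOut i≢j) (there (punchOut i≢j))

∈-insertAt⁻ : ∀ (S : Subset n) i {s} {j} → punchIn i j ∈ insertAt S i s → j ∈ S
∈-insertAt⁻ S i {s} {j} j∈ =
  lookup⇒[]= j S (trans (sym (insertAt-punchIn S i s j)) ([]=⇒lookup j∈))

∈-insertAt⁺ : ∀ (S : Subset n) i {s} {j} → j ∈ S → punchIn i j ∈ insertAt S i s
∈-insertAt⁺ S i {s} {j} j∈ =
  lookup⇒[]= (punchIn i j) _ (trans (insertAt-punchIn S i s j) ([]=⇒lookup j∈))

∈-insertAt-inside : ∀ (S : Subset n) i → i ∈ insertAt S i inside
∈-insertAt-inside S i = lookup⇒[]= i _ (insertAt-lookup S i inside)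

∉-insertAt-outside : ∀ (S : Subset n) i → i ∉ insertAt S i outside
∉-insertAt-outside S i i∈ with () ← trans (sym ([]=⇒lookup i∈)) (insertAt-lookup S i outside)

insertAt-outside⊆inside : ∀ (S : Subset n) i → insertAt S i outside ⊆ insertAt S i inside
insertAt-outside⊆inside S i {x} x∈ with around i x
... | here    = ∈-insertAt-inside S i
... | there j = ∈-insertAt⁺ S i (∈-insertAt⁻ S i x∈)

∣insertAt-outside∣ : ∀ (S : Subset n) i → ∣ insertAt S i outside ∣ ≡ ∣ S ∣
∣insertAt-outside∣ S             zero    = refl
∣insertAt-outside∣ (inside  ∷ S) (suc i) = cong suc (∣insertAt-outside∣ S i)
∣insertAt-outside∣ (outside ∷ S) (suc i) = ∣insertAt-outside∣ S i

∣insertAt-inside∣ : ∀ (S : Subset n) i → ∣ insertAt S i inside ∣ ≡ suc ∣ S ∣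
∣insertAt-inside∣ S             zero    = refl
∣insertAt-inside∣ (inside  ∷ S) (suc i) = cong suc (∣insertAt-inside∣ S i)
∣insertAt-inside∣ (outside ∷ S) (suc i) = ∣insertAt-inside∣ S i

-- Counting subsets

opaque
  count : ∀ {n} {P : Pred (Subset n) 0ℓ} → U.Decidable P → ℕ
  count P? = length (filter P? (subsets _))

  count-mono : ∀ {P Q : Pred (Subset n) 0ℓ} (P? : U.Decidable P) (Q? : U.Decidable Q) →
    P U.⊆ Q → count P? ≤ count Q?
  count-mono P? Q? P⊆Q = Sublist.length-mono-≤ (setoid _)
    (Sublist.filter⁺ (setoid _) P? Q? (λ { refl → P⊆Q }) (Sublist.⊆-refl {x = subsets _}))

length-filter-map : ∀ {A B : Set} {P : Pred B 0ℓ} (P? : U.Decidable P) (f : A → B) xs →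
  length (filter P? (map f xs)) ≡ length (filter (P? ∘ f) xs)
length-filter-map P? f []       = refl
length-filter-map P? f (x ∷ xs) with ih ← length-filter-map P? f xs | P? (f x)
... | yes _ = cong suc ih
... | no  _ = ih

length-filter-complement : ∀ {A : Set} {P Q : Pred A 0ℓ}
  (P? : U.Decidable P) (Q? : U.Decidable Q) xs →
  length (filter (λ x → P? x ×-dec Q? x) xs) + length (filter (λ x → P? x ×-dec ¬? (Q? x)) xs)
    ≡ length (filter P? xs)
length-filter-complement P? Q? []       = refl
length-filter-complement P? Q? (x ∷ xs)
  with ih ← length-filter-complement P? Q? xs | P? x | Q? x
... | yes _ | yes _ = cong suc ih
... | yes _ | no  _ = trans (ℕ.+-suc _ _) (cong suc ih)
... | no  _ | yes _ = ih
... | no  _ | no  _ = ih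

opaque
  unfolding count

  -- The case `zero` is how `subsets` is built; the other cases follow by induction on `i`. With `P`
  -- a condition on size alone, this is Pascal's rule.
  count-split : ∀ {P : Pred (Subset (suc n)) 0ℓ} (P? : U.Decidable P) (i : Fin (suc n)) →
    count P? ≡ count (λ S → P? (insertAt S i outside)) + count (λ S → P? (insertAt S i inside))
  count-split {n = n} P? zero = begin
    length (filter P? (map (outside ∷_) (subsets n) ++ map (inside ∷_) (subsets n)))
      ≡⟨ cong length (filter-++ P? (map (outside ∷_) (subsets n)) _) ⟩
    length (filter P? (map (outside ∷_) (subsets n)) ++ filter P? (map (inside ∷_) (subsets n)))
      ≡⟨ length-++ (filter P? (map (outside ∷_) (subsets n))) ⟩
    length (filter P? (map (outside ∷_) (subsets n))) + length (filter P? (map (inside ∷_) (subsets n)))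
      ≡⟨ cong₂ _+_ (length-filter-map P? (outside ∷_) (subsets n))
                   (length-filter-map P? (inside ∷_) (subsets n)) ⟩
    count (λ S → P? (outside ∷ S)) + count (λ S → P? (inside ∷ S)) ∎
    where open ≡-Reasoning
  count-split {n = suc n} P? (suc i) = begin
    count P?
      ≡⟨ count-split P? zero ⟩
    count (λ S → P? (outside ∷ S)) + count (λ S → P? (inside ∷ S))
      ≡⟨ cong₂ _+_ (count-split (λ S → P? (outside ∷ S)) i) (count-split (λ S → P? (inside ∷ S)) i) ⟩
    (c outside outside + c outside inside) + (c inside outside + c inside inside)
      -- The four classes, given by the colours of the first vertex and of vertex `suc i`, are
      -- regrouped by the latter.
      ≡⟨ interchange ℕ.+-commutativeSemigroup (c outside outside) _ _ _ ⟩
    (c outside outside + c inside outside) + (c outside inside + c inside inside)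
      ≡⟨ cong₂ _+_ (count-split (λ S → P? (insertAt S (suc i) outside)) zero)
                   (count-split (λ S → P? (insertAt S (suc i) inside)) zero) ⟨
    count (λ S → P? (insertAt S (suc i) outside)) + count (λ S → P? (insertAt S (suc i) inside)) ∎
    where
    open ≡-Reasoning
    c : Side → Side → ℕ
    c x y = count (λ S → P? (x ∷ insertAt S i y))

-- Sizes range over a predicate K on ℕ instead of being a number k: removing an
-- element replaces K by K ∘ suc, which needs no case distinction at k = 0.
binomial : ∀ n → U.Decidable K → ℕ
binomial n K? = count {n = n} (K? ∘ ∣_∣)

module _ (G : Graph n) (K? : U.Decidable K) where

  Failing : Pred (Subset n) 0ℓ
  Failing S = K ∣ S ∣ × ¬ ZeroForcing G S

  opaque
    failing? : U.Decidable Failing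
    failing? S = K? ∣ S ∣ ×-dec ¬? (zeroForcing? G S)

  failures : ℕ
  failures = count failing?

opaque
  unfolding count failing?

  -- The sum depends on `n` and `k` alone, so an upper bound on `z` amounts to a lower bound on
  -- `failures`.
  z+failures : ∀ (G : Graph n) k → z G k + failures G (ℕ._≟ k) ≡ binomial n (ℕ._≟ k)
  z+failures {n} G k = length-filter-complement (λ S → ∣ S ∣ ℕ.≟ k) (zeroForcing? G) (subsets n)

-- Forts

record Fort (G : Graph n) (S : Subset n) (W : Pred (Fin n) 0ℓ) : Set where
  open Graph G
  field
    avoids    : ∀ {x} → x ∈ S → ¬ W x
    inhabited : ∃[ x ] W x
    spread    : ∀ {x w} → ¬ W x → x ~ w → W w → ∃[ y ] y ≢ w × x ~ y × W y

-- A force never enters a fort: the forcing vertex is blue, hence outside `W`, and a neighbour in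
-- `W` comes with a second one, also white. So `W` stays white throughout the run, which therefore
-- cannot end at the full set.
fort⇒failing : ∀ {G : Graph n} {S W} → Fort G S W → ¬ ZeroForcing G S
fort⇒failing fort ε = Fort.avoids fort ∈⊤ (proj₂ (Fort.inhabited fort))
fort⇒failing {G = G} {S} {W} fort (force {v} {w} (v∈S , w∉S , v~w , unique) ◅ run) =
  fort⇒failing (record { avoids = avoids′ ; inhabited = inhabited ; spread = spread }) run
  where
  open Fort fort

  ¬Ww : ¬ W w
  ¬Ww Ww with y , y≢w , v~y , Wy ← spread (avoids v∈S) v~w Ww =
    y≢w (unique y v~y (λ y∈S → avoids y∈S Wy))

  avoids′ : ∀ {x} → x ∈ S ∪ ⁅ w ⁆ → ¬ W x
  avoids′ x∈ with x∈p∪q⁻ S ⁅ w ⁆ x∈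
  ... | inj₁ x∈S = avoids x∈S
  ... | inj₂ x∈w = subst (¬_ ∘ W) (sym (x∈⁅y⁆⇒x≡y w x∈w)) ¬Ww

failing⇒fort : ∀ {G : Graph n} {S} → ¬ ZeroForcing G S → ∃[ W ] U.Decidable W × Fort G S W
failing⇒fort {n} {G} {S} = complement-of-closure S (⊃-wellFounded S)
  where
  open Graph G

  complement-of-closure : ∀ S → Acc _⊃_ S → ¬ ZeroForcing G S →
    ∃[ W ] U.Decidable W × Fort G S W
  complement-of-closure S (acc rec) ¬zf with Fin.any? (λ v → Fin.any? (forces? G S v))
  ... | yes (v , w , f@(_ , w∉S , _))
    with W , W? , fort ← complement-of-closure (S ∪ ⁅ w ⁆)
           (rec (p⊆p∪q ⁅ w ⁆ , w , x∈p∪q⁺ (inj₂ (x∈⁅x⁆ w)) , w∉S)) (λ run → ¬zf (force f ◅ run)) =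
    W , W? , record
      { avoids    = λ x∈S → Fort.avoids fort (p⊆p∪q ⁅ w ⁆ x∈S)
      ; inhabited = Fort.inhabited fort
      ; spread    = Fort.spread fort
      }
  ... | no stuck = (_∉ S) , (λ x → ¬? (x ∈? S)) , record
    { avoids    = λ x∈S x∉S → x∉S x∈S
    ; inhabited = Fin.¬∀⟶∃¬ n (_∈ S) (_∈? S) λ all →
        ¬zf (subst (ZeroForcing G) (⊆-antisym (λ {x} _ → all x) ⊆⊤) ε)
    ; spread    = spread
    }
    where
    spread : ∀ {x w} → ¬ (x ∉ S) → x ~ w → w ∉ S → ∃[ y ] y ≢ w × x ~ y × y ∉ S
    spread {x} {w} x∈S x~w w∉S
      with Fin.any? (λ y → ¬? (y Fin.≟ w) ×-dec (x ~? y) ×-dec ¬? (y ∈? S))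
    ... | yes y   = y
    ... | no  ¬∃y = ⊥-elim $ stuck $ x , w , decidable-stable (x ∈? S) x∈S , w∉S , x~w ,
      λ y x~y y∉S → decidable-stable (y Fin.≟ w) (λ y≢w → ¬∃y (y , y≢w , x~y , y∉S))

-- Failure is transferred from one graph to another by transforming forts; all injections between
-- families of failing sets below arise this way.
failing-map : ∀ {G : Graph m} {H : Graph n} {S T} →
  (∀ {W} → U.Decidable W → Fort G S W → ∃[ V ] Fort H T V) →
  ¬ ZeroForcing G S → ¬ ZeroForcing H T
failing-map f ¬zf with _ , W? , fort ← failing⇒fort ¬zf = fort⇒failing (proj₂ (f W? fort))

-- The path

module _ {n : ℕ} where
  open Graph (Path n)

  ~-suc : ∀ {i j : Fin n} → i ~ j → Graph._~_ (Path (suc n)) (suc i) (suc j)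
  ~-suc (inj₁ p) = inj₁ (cong suc p)
  ~-suc (inj₂ p) = inj₂ (cong suc p)

  ~-pred : ∀ {i j : Fin n} → Graph._~_ (Path (suc n)) (suc i) (suc j) → i ~ j
  ~-pred (inj₁ p) = inj₁ (ℕ.suc-injective p)
  ~-pred (inj₂ p) = inj₂ (ℕ.suc-injective p)

-- Otherwise the predecessor of the first vertex of `W` lies outside `W` and has exactly one
-- neighbour in `W`.
path-fort-zero : ∀ {S W} → U.Decidable W → Fort (Path (suc n)) S W → W zero
path-fort-zero {n} {S} {W} W? fort = decidable-stable (W? zero) λ ¬W₀ →
  let x , Wx = inhabited in ¬W ¬W₀ x (<-wellFounded x) Wx
  where
  open Fort fort

  ¬W : ¬ W zero → ∀ i → Acc Fin._<_ i → ¬ W i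
  ¬W ¬W₀ zero    _         = ¬W₀
  ¬W ¬W₀ (suc i) (acc rec) W₁₊ᵢ
    with spread (¬W ¬W₀ (inject₁ i) (rec (s≤s (ℕ.≤-reflexive (Fin.toℕ-inject₁ i)))))
                (inj₁ (cong suc (Fin.toℕ-inject₁ i))) W₁₊ᵢ
  ... | y , y≢ , inj₁ p , Wy = y≢ (Fin.toℕ-injective (trans (sym p) (cong suc (Fin.toℕ-inject₁ i))))
  ... | y , y≢ , inj₂ p , Wy = ¬W ¬W₀ y (rec y<i) Wy
    where
    y<i : suc (toℕ y) ≤ suc (toℕ i)
    y<i = ℕ.≤-trans (ℕ.≤-reflexive (trans p (Fin.toℕ-inject₁ i))) (ℕ.n≤1+n _)

-- The first vertex is in `W`. If the second is not, it needs another neighbour in `W`, which can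
-- only be the third.
path-fort-one : ∀ {S W} → U.Decidable W → Fort (Path (3 + n)) S W →
  ¬ W (suc (suc zero)) → W (suc zero)
path-fort-one {n} {W = W} W? fort ¬W₂ = decidable-stable (W? (suc zero)) λ ¬W₁ →
  impossible (Fort.spread fort ¬W₁ (inj₂ refl) (path-fort-zero W? fort))
  where
  impossible : ¬ (∃[ y ] y ≢ zero × Graph._~_ (Path (3 + n)) (suc zero) y × W y)
  impossible (zero              , y≢ , _       , _)  = y≢ refl
  impossible (suc zero          , _  , inj₁ () , _)
  impossible (suc zero          , _  , inj₂ () , _)
  impossible (suc (suc zero)    , _  , _       , W₂) = ¬W₂ W₂
  impossible (suc (suc (suc _)) , _  , inj₁ () , _)
  impossible (suc (suc (suc _)) , _  , inj₂ () , _)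

-- The second vertex becomes the first one of the new path and joins the fort: it
-- was in W already unless the third vertex is, by path-fort-one.
path-fort-tail : ∀ {s T W} → U.Decidable W → Fort (Path (2 + n)) (outside ∷ s ∷ T) W →
  ∃[ V ] Fort (Path (suc n)) (outside ∷ T) V
path-fort-tail {n} {s} {T} {W} W? fort = V , record
  { avoids    = avoids′
  ; inhabited = zero , tt
  ; spread    = λ {x} {w} → spread′ x w
  }
  where
  open Fort fort
  open Graph (Path (suc n))

  V : Pred (Fin (suc n)) 0ℓ
  V zero    = ⊤
  V (suc i) = W (suc (suc i))

  avoids′ : ∀ {x} → x ∈ outside ∷ T → ¬ V x
  avoids′ (there x∈) = avoids (there (there x∈))

  spread′ : ∀ x w → ¬ V x → x ~ w → V w → ∃[ y ] y ≢ w × x ~ y × V y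
  spread′ zero    w    ¬Vx x~w Vw = ⊥-elim (¬Vx tt)
  -- The vertex `suc zero` was third on the longer path, and the second vertex there is in `W`. So
  -- `spread` leads to a neighbour on the far side.
  spread′ (suc zero) zero ¬Vx x~w Vw
    with spread ¬Vx (inj₂ refl) (path-fort-one W? fort ¬Vx)
  ... | zero          , y≢ , inj₁ () , Wy
  ... | zero          , y≢ , inj₂ () , Wy
  ... | suc zero      , y≢ , p       , Wy = ⊥-elim (y≢ refl)
  ... | suc (suc y)   , y≢ , p       , Wy = suc y , (λ ()) , ~-pred p , Wy
  spread′ (suc (suc x)) zero ¬Vx (inj₁ ()) Vw
  spread′ (suc (suc x)) zero ¬Vx (inj₂ ()) Vw
  spread′ (suc x) (suc w) ¬Vx x~w Vw with spread ¬Vx (~-suc x~w) Vw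
  ... | zero          , y≢ , inj₁ () , Wy
  ... | zero          , y≢ , inj₂ () , Wy
  ... | suc zero      , y≢ , p       , Wy = zero , (λ ()) , ~-pred p , tt
  ... | suc (suc y)   , y≢ , p       , Wy = suc y , y≢ ∘ cong suc , ~-pred p , Wy

-- The blue second vertex lies outside `W` and separates the first vertex from the rest, so the
-- restriction of `W` keeps the fort property. It is nonempty because the second vertex, being
-- adjacent to the first, has another neighbour in `W`.
path-fort-tail² : ∀ {T W} → U.Decidable W → Fort (Path (2 + n)) (outside ∷ inside ∷ T) W →
  ∃[ V ] Fort (Path n) T V
path-fort-tail² {n} {T} {W} W? fort = (λ i → W (suc (suc i))) , record
  { avoids    = λ x∈ → avoids (there (there x∈))
  ; inhabited = inhabited′ (spread ¬W₁ (inj₂ refl) (path-fort-zero W? fort))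
  ; spread    = λ ¬Vx x~w Vw → spread′ (spread ¬Vx (~-suc (~-suc x~w)) Vw)
  }
  where
  open Fort fort
  open Graph (Path n)

  ¬W₁ : ¬ W (suc zero)
  ¬W₁ = avoids (there here)

  inhabited′ : ∃[ y ] y ≢ zero × Graph._~_ (Path (2 + n)) (suc zero) y × W y →
    ∃[ x ] W (suc (suc x))
  inhabited′ (zero        , y≢ , _ , Wy) = ⊥-elim (y≢ refl)
  inhabited′ (suc zero    , y≢ , _ , Wy) = ⊥-elim (¬W₁ Wy)
  inhabited′ (suc (suc y) , y≢ , _ , Wy) = y , Wy

  spread′ : ∀ {x w} →
    ∃[ y ] y ≢ suc (suc w) × Graph._~_ (Path (2 + n)) (suc (suc x)) y × W y →
    ∃[ y ] y ≢ w × x ~ y × W (suc (suc y))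
  spread′ (zero        , y≢ , inj₁ () , Wy)
  spread′ (zero        , y≢ , inj₂ () , Wy)
  spread′ (suc zero    , y≢ , _ , Wy) = ⊥-elim (¬W₁ Wy)
  spread′ (suc (suc y) , y≢ , p , Wy) = y , (λ { refl → y≢ refl }) , ~-pred (~-pred p) , Wy

-- Every fort contains the end vertex, so a set containing that vertex avoids no fort.
path-inside-forces : ∀ {T : Subset n} → ZeroForcing (Path (suc n)) (inside ∷ T)
path-inside-forces {T = T} = decidable-stable (zeroForcing? _ (inside ∷ T)) λ ¬zf →
  let _ , W? , fort = failing⇒fort ¬zf in Fort.avoids fort here (path-fort-zero W? fort)

-- Counting failing sets of the path

opaque
  unfolding count

  count-∅ : ∀ {P : Pred (Subset n) 0ℓ} (P? : U.Decidable P) → P U.⊆ U.∅ → count P? ≡ 0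
  count-∅ {n = n} P? empty = go (subsets n)
    where
    go : ∀ xs → length (filter P? xs) ≡ 0
    go []       = refl
    go (x ∷ xs) with P? x
    ... | yes p = ⊥-elim (empty p)
    ... | no  _ = go xs

failures-Path-0 : (K? : U.Decidable K) → failures (Path 0) K? ≡ 0
failures-Path-0 K? = count-∅ (failing? (Path 0) K?) λ { {[]} (_ , ¬zf) → ¬zf ε }

failures-Path-outside : ∀ n (K? : U.Decidable K) →
  failures (Path (suc n)) K? ≡ count (λ S → failing? (Path (suc n)) K? (outside ∷ S))
failures-Path-outside n K? = begin
  failures (Path (suc n)) K?
    ≡⟨ count-split F? zero ⟩
  count (λ S → F? (outside ∷ S)) + count (λ S → F? (inside ∷ S))
    ≡⟨ cong (count (λ S → F? (outside ∷ S)) +_)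
            (count-∅ (λ S → F? (inside ∷ S)) (λ (_ , ¬zf) → ¬zf path-inside-forces)) ⟩
  count (λ S → F? (outside ∷ S)) + 0
    ≡⟨ ℕ.+-identityʳ _ ⟩
  count (λ S → F? (outside ∷ S)) ∎
  where
  open ≡-Reasoning
  F? = failing? (Path (suc n)) K?

-- The first vertex of a failing set's path is white. If the second is white too, one of them is
-- deleted; if it is blue, both are deleted, and the lost blue vertex accounts for `K? ∘ suc`.
failures-Path-suc-suc : ∀ n (K? : U.Decidable K) →
  failures (Path (2 + n)) K? ≤ failures (Path (suc n)) K? + failures (Path n) (K? ∘ suc)
failures-Path-suc-suc n K? = begin
  failures (Path (2 + n)) K?
    ≡⟨ failures-Path-outside (suc n) K? ⟩
  count (λ S → F? (outside ∷ S))
    ≡⟨ count-split (λ S → F? (outside ∷ S)) zero ⟩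
  count (λ S → F? (outside ∷ outside ∷ S)) + count (λ S → F? (outside ∷ inside ∷ S))
    ≤⟨ ℕ.+-mono-≤
         (count-mono (λ S → F? (outside ∷ outside ∷ S)) (λ S → failing? (Path (suc n)) K? (outside ∷ S))
           (λ (k , ¬zf) → k , failing-map path-fort-tail ¬zf))
         (count-mono (λ S → F? (outside ∷ inside ∷ S)) (failing? (Path n) (K? ∘ suc))
           (λ (k , ¬zf) → k , failing-map path-fort-tail² ¬zf)) ⟩
  count (λ S → failing? (Path (suc n)) K? (outside ∷ S)) + failures (Path n) (K? ∘ suc)
    ≡⟨ cong (_+ failures (Path n) (K? ∘ suc)) (failures-Path-outside n K?) ⟨
  failures (Path (suc n)) K? + failures (Path n) (K? ∘ suc) ∎
  where
  open ℕ.≤-Reasoning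
  F? = failing? (Path (2 + n)) K?

failures-Path-1+ : ∀ n (K? : U.Decidable K) → failures (Path (suc n)) K? ≤ binomial n K?
failures-Path-1+ n K? = begin
  failures (Path (suc n)) K?
    ≡⟨ failures-Path-outside n K? ⟩
  count (λ S → failing? (Path (suc n)) K? (outside ∷ S))
    ≤⟨ count-mono (λ S → failing? (Path (suc n)) K? (outside ∷ S)) (K? ∘ ∣_∣) proj₁ ⟩
  binomial n K? ∎
  where open ℕ.≤-Reasoning

-- Induction along the recurrence, whose second term is bounded by `failures-Path-1+`. The base case
-- rests on the empty path having no failing sets.
failures-Path-2+ : ∀ n (K? : U.Decidable K) → failures (Path (2 + n)) K? ≤ binomial n K?
failures-Path-2+ zero K? = begin
  failures (Path 2) K?
    ≤⟨ failures-Path-suc-suc 0 K? ⟩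
  failures (Path 1) K? + failures (Path 0) (K? ∘ suc)
    ≡⟨ cong (failures (Path 1) K? +_) (failures-Path-0 (K? ∘ suc)) ⟩
  failures (Path 1) K? + 0
    ≡⟨ ℕ.+-identityʳ _ ⟩
  failures (Path 1) K?
    ≤⟨ failures-Path-1+ 0 K? ⟩
  binomial 0 K? ∎
  where open ℕ.≤-Reasoning
failures-Path-2+ (suc n) K? = begin
  failures (Path (3 + n)) K?
    ≤⟨ failures-Path-suc-suc (suc n) K? ⟩
  failures (Path (2 + n)) K? + failures (Path (suc n)) (K? ∘ suc)
    ≤⟨ ℕ.+-mono-≤ (failures-Path-2+ n K?) (failures-Path-1+ n (K? ∘ suc)) ⟩
  binomial n K? + binomial n (K? ∘ suc)
    -- Pascal's rule.
    ≡⟨ count-split (K? ∘ ∣_∣) zero ⟨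
  binomial (suc n) K? ∎
  where open ℕ.≤-Reasoning

-- Isolated vertices, twins and leaves

infixl 6 _∖_

induced : Graph n → (Fin m → Fin n) → Graph m
induced G f = record
  { _~_   = λ x y → f x ~ f y
  ; _~?_  = λ x y → f x ~? f y
  ; ~-sym = ~-sym
  ; ~-irr = ~-irr
  }
  where open Graph G

_∖_ : Graph (suc n) → Fin (suc n) → Graph n
G ∖ i = induced G (punchIn i)

module _ (G : Graph (suc n)) (u : Fin (suc n)) where
  open Graph G

  isolated-failures : (∀ w → ¬ u ~ w) → (K? : U.Decidable K) → binomial n K? ≤ failures G K?
  isolated-failures {K = K} isolated K? = begin
    binomial n K?
      ≤⟨ count-mono (K? ∘ ∣_∣) (λ S → failing? G K? (insertAt S u outside))
           (λ {S} k → subst K (sym (∣insertAt-outside∣ S u)) k , fort⇒failing (fort S)) ⟩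
    count (λ S → failing? G K? (insertAt S u outside))
      ≤⟨ ℕ.m≤m+n _ _ ⟩
    count (λ S → failing? G K? (insertAt S u outside)) + count (λ S → failing? G K? (insertAt S u inside))
      ≡⟨ count-split (failing? G K?) u ⟨
    failures G K? ∎
    where
    open ℕ.≤-Reasoning
    fort : ∀ S → Fort G (insertAt S u outside) (_≡ u)
    fort S = record
      { avoids    = λ { x∈ refl → ∉-insertAt-outside S u x∈ }
      ; inhabited = u , refl
      ; spread    = λ { _ x~u refl → ⊥-elim (isolated _ (~-sym x~u)) }
      }

module _ (G : Graph (2 + n)) (u : Fin (2 + n)) (v′ : Fin (suc n)) where
  open Graph G

  private
    -- The second vertex is given by its index `v′` in the graph without `u`, so that inserting at
    -- `v′` and then at `u` yields every subset exactly once.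
    v : Fin (2 + n)
    v = punchIn u v′

    u≢v : u ≢ v
    u≢v = Fin.punchInᵢ≢i u v′ ∘ sym

    _+v_+u_ : Subset n → Side → Side → Subset (2 + n)
    S +v a +u b = insertAt (insertAt S v′ a) u b

    u∉ : ∀ S a → u ∉ S +v a +u outside
    u∉ S a = ∉-insertAt-outside (insertAt S v′ a) u

    v∉ : ∀ S b → v ∉ S +v outside +u b
    v∉ S b = ∉-insertAt-outside S v′ ∘ ∈-insertAt⁻ (insertAt S v′ outside) u

    size-oo : ∀ S → ∣ S +v outside +u outside ∣ ≡ ∣ S ∣
    size-oo S = trans (∣insertAt-outside∣ _ u) (∣insertAt-outside∣ S v′)

    size-io : ∀ S → ∣ S +v inside +u outside ∣ ≡ suc ∣ S ∣
    size-io S = trans (∣insertAt-outside∣ _ u) (∣insertAt-inside∣ S v′)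

    size-oi : ∀ S → ∣ S +v outside +u inside ∣ ≡ suc ∣ S ∣
    size-oi S = trans (∣insertAt-inside∣ _ u) (cong suc (∣insertAt-outside∣ S v′))

  module _ (K? : U.Decidable K) where

    private
      F? : ∀ a b → U.Decidable (λ S → Failing G K? (S +v a +u b))
      F? a b S = failing? G K? (S +v a +u b)

    failures-split : failures G K? ≡
      (count (F? outside outside) + count (F? inside outside)) +
      (count (F? outside inside) + count (F? inside inside))
    failures-split = trans (count-split (failing? G K?) u) (cong₂ _+_
      (count-split (λ S → failing? G K? (insertAt S u outside)) v′)
      (count-split (λ S → failing? G K? (insertAt S u inside)) v′))

    -- A vertex other than `u` and `v` is adjacent to both or to neither, so the pair is a fort.
    -- Adjacency between `u` and `v` is left open, which treats true and false twins alike.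
    twins-failures : (∀ w → w ≢ u → w ≢ v → u ~ w ⇔ v ~ w) → binomial n K? ≤ failures G K?
    twins-failures twins = begin
      binomial n K?
        ≤⟨ count-mono (K? ∘ ∣_∣) (F? outside outside)
             (λ {S} k → subst K (sym (size-oo S)) k , fort⇒failing (fort S)) ⟩
      count (F? outside outside)
        ≤⟨ ℕ.m≤m+n _ _ ⟩
      count (F? outside outside) + count (F? inside outside)
        ≤⟨ ℕ.m≤m+n _ _ ⟩
      (count (F? outside outside) + count (F? inside outside)) +
      (count (F? outside inside) + count (F? inside inside))
        ≡⟨ failures-split ⟨
      failures G K? ∎
      where
      open ℕ.≤-Reasoning
      W : Pred (Fin (2 + n)) 0ℓ
      W x = x ≡ u ⊎ x ≡ v

      fort : ∀ S → Fort G (S +v outside +u outside) W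
      fort S = record
        { avoids    = λ { x∈ (inj₁ refl) → u∉ S outside x∈ ; x∈ (inj₂ refl) → v∉ S outside x∈ }
        ; inhabited = u , inj₁ refl
        ; spread    = λ
            { {x} ¬Wx x~w (inj₁ refl) → v , u≢v ∘ sym ,
                ~-sym (Equivalence.to (twins x (¬Wx ∘ inj₁) (¬Wx ∘ inj₂)) (~-sym x~w)) , inj₂ refl
            ; {x} ¬Wx x~w (inj₂ refl) → u , u≢v ,
                ~-sym (Equivalence.from (twins x (¬Wx ∘ inj₁) (¬Wx ∘ inj₂)) (~-sym x~w)) , inj₁ refl
            }
        }

    module _ (u~v : u ~ v) (leaf : ∀ w → u ~ w → w ≡ v) where

      private
        leaf′ : ∀ {w} → w ~ u → w ≡ v
        leaf′ = leaf _ ∘ ~-sym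

        -- The image of `W` in `G`, together with `u` precisely when the proposition `U` holds.
        data Lift (W : Pred (Fin (suc n)) 0ℓ) (U : Set) : Pred (Fin (2 + n)) 0ℓ where
          old : ∀ {x} → W x → Lift W U (punchIn u x)
          new : U → Lift W U u

        -- The leaf `u` joins the fort exactly when `v` belongs to it. Then `u` never sees `v` as
        -- its only fort neighbour from outside, and `v` never sees `u` from outside.
        fort-o : ∀ {T W} → Fort (G ∖ u) T W → Fort G (insertAt T u outside) (Lift W (W v′))
        fort-o {T} {W} fort = record
          { avoids    = λ where
              x∈ (old Wx) → avoids (∈-insertAt⁻ T u x∈) Wx
              x∈ (new _)  → ∉-insertAt-outside T u x∈
          ; inhabited = _ , old (proj₂ inhabited)
          ; spread    = λ {x} → spread′ (around u x)
          }
          where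
          open Fort fort
          V = Lift W (W v′)
          spread′ : ∀ {x w} → Around u x → ¬ V x → x ~ w → V w → ∃[ y ] y ≢ w × x ~ y × V y
          spread′ here      ¬Vx x~w (new Wv) = ⊥-elim (~-irr x~w)
          spread′ here      ¬Vx x~w (old Ww) =
            ⊥-elim (¬Vx (new (subst W (Fin.punchIn-injective u _ _ (leaf _ x~w)) Ww)))
          spread′ (there x) ¬Vx x~w (new Wv) =
            ⊥-elim (¬Vx (old (subst W (sym (Fin.punchIn-injective u _ _ (leaf′ x~w))) Wv)))
          spread′ (there x) ¬Vx x~w (old Ww) with y , y≢w , x~y , Wy ← spread (¬Vx ∘ old) x~w Ww =
            punchIn u y , y≢w ∘ Fin.punchIn-injective u _ _ , x~y , old Wy

        -- Blue moves from `v` to `u`, which keeps the size compared with `insertAt S v′ inside`. As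
        -- `v` was blue, it is outside `W`, so `u` has no neighbour in the fort.
        fort-oi : ∀ {S W} → Fort (G ∖ u) (insertAt S v′ inside) W →
          Fort G (S +v outside +u inside) (Lift W ⊥)
        fort-oi {S} {W} fort = record
          { avoids    = λ where
              x∈ (old Wx) → avoids (insertAt-outside⊆inside S v′ (∈-insertAt⁻ _ u x∈)) Wx
          ; inhabited = _ , old (proj₂ inhabited)
          ; spread    = λ {x} → spread′ (around u x)
          }
          where
          open Fort fort
          V = Lift W ⊥
          spread′ : ∀ {x w} → Around u x → ¬ V x → x ~ w → V w → ∃[ y ] y ≢ w × x ~ y × V y
          spread′ here      ¬Vx x~w (old Ww) = ⊥-elim $
            avoids (∈-insertAt-inside S v′) (subst W (Fin.punchIn-injective u _ _ (leaf _ x~w)) Ww)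
          spread′ (there x) ¬Vx x~w (old Ww) with y , y≢w , x~y , Wy ← spread (¬Vx ∘ old) x~w Ww =
            punchIn u y , y≢w ∘ Fin.punchIn-injective u _ _ , x~y , old Wy

        -- Here v is blue, so u must join the fort as soon as v has a neighbour in it.
        fort-io : ∀ {S W} → Fort (G ∖ u ∖ v′) S W → ∃[ V ] Fort G (S +v inside +u outside) V
        fort-io {S} {W} fort = V , record
          { avoids    = avoids′
          ; inhabited = _ , old _ (proj₂ inhabited)
          ; spread    = λ {x} → spread′ (around u x)
          }
          where
          open Fort fort
          i : Fin n → Fin (2 + n)
          i = punchIn u ∘ punchIn v′

          i-injective : ∀ {x y} → i x ≡ i y → x ≡ y
          i-injective = Fin.punchIn-injective v′ _ _ ∘ Fin.punchIn-injective u _ _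

          i≢v : ∀ {x} → i x ≢ v
          i≢v = Fin.punchInᵢ≢i v′ _ ∘ Fin.punchIn-injective u _ _

          data V : Pred (Fin (2 + n)) 0ℓ where
            old : ∀ x → W x → V (i x)
            new : ∀ x → W x → v ~ i x → V u

          avoids′ : ∀ {x} → x ∈ S +v inside +u outside → ¬ V x
          avoids′ x∈ (old x Wx)   = avoids (∈-insertAt⁻ S v′ (∈-insertAt⁻ _ u x∈)) Wx
          avoids′ x∈ (new _ _ _) = u∉ S inside x∈

          spread′ : ∀ {x w} → Around u x → ¬ V x → x ~ w → V w → ∃[ y ] y ≢ w × x ~ y × V y
          spread′ here ¬Vx x~w (old w Ww)     = ⊥-elim (i≢v (leaf _ x~w))
          spread′ here ¬Vx x~w (new w Ww v~w) = ⊥-elim (~-irr x~w)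
          spread′ (there x) ¬Vx x~w Vw with around v′ x | Vw
          -- For the vertex `v`, the leaf `u` and a neighbour from the old fort serve as each
          -- other's second neighbour.
          ... | here    | old w Ww     =
            u , Fin.punchInᵢ≢i u _ ∘ sym , ~-sym u~v , new w Ww x~w
          ... | here    | new y Wy v~y = i y , Fin.punchInᵢ≢i u _ , v~y , old y Wy
          ... | there x | new w Ww v~w = ⊥-elim (i≢v (leaf′ x~w))
          ... | there x | old w Ww with y , y≢w , x~y , Wy ← spread (¬Vx ∘ old x) x~w Ww =
            i y , y≢w ∘ i-injective , x~y , old y Wy

      -- Sort the failing sets of `G` by the colours of `u` and `v`. Three classes receive,
      -- injectively, the failing sets of the smaller graphs: `fort-o` fills both white, `fort-oi`
      -- only `u` blue, and `fort-io` only `v` blue, where the extra blue vertex gives `K? ∘ suc`.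
      leaf-failures : failures (G ∖ u) K? + failures (G ∖ u ∖ v′) (K? ∘ suc) ≤ failures G K?
      leaf-failures = begin
        failures (G ∖ u) K? + failures (G ∖ u ∖ v′) (K? ∘ suc)
          ≡⟨ cong (_+ failures (G ∖ u ∖ v′) (K? ∘ suc)) (count-split (failing? (G ∖ u) K?) v′) ⟩
        count (λ S → failing? (G ∖ u) K? (insertAt S v′ outside)) +
        count (λ S → failing? (G ∖ u) K? (insertAt S v′ inside)) +
        failures (G ∖ u ∖ v′) (K? ∘ suc)
          ≤⟨ ℕ.+-mono-≤ (ℕ.+-mono-≤
               (count-mono (λ S → failing? (G ∖ u) K? (insertAt S v′ outside)) (F? outside outside)
                 (λ {S} (k , ¬zf) → subst K (sym (∣insertAt-outside∣ _ u)) k ,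
                   failing-map (λ _ fort → _ , fort-o fort) ¬zf))
               (count-mono (λ S → failing? (G ∖ u) K? (insertAt S v′ inside)) (F? outside inside)
                 (λ {S} (k , ¬zf) → subst K (trans (∣insertAt-inside∣ S v′) (sym (size-oi S))) k ,
                   failing-map (λ _ fort → _ , fort-oi fort) ¬zf)))
               (count-mono (failing? (G ∖ u ∖ v′) (K? ∘ suc)) (F? inside outside)
                 (λ {S} (k , ¬zf) → subst K (sym (size-io S)) k , failing-map (λ _ → fort-io) ¬zf)) ⟩
        count (F? outside outside) + count (F? outside inside) + count (F? inside outside)
          ≡⟨ xy∙z≈xz∙y ℕ.+-commutativeSemigroup (count (F? outside outside)) _ _ ⟩
        count (F? outside outside) + count (F? inside outside) + count (F? outside inside)
          -- The class with `u` and `v` both blue is added.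
          ≤⟨ ℕ.+-monoʳ-≤ (count (F? outside outside) + count (F? inside outside)) (ℕ.m≤m+n _ _) ⟩
        (count (F? outside outside) + count (F? inside outside)) +
        (count (F? outside inside) + count (F? inside inside))
          ≡⟨ failures-split ⟨
        failures G K? ∎
        where open ℕ.≤-Reasoning

-- Distance-hereditary graphs

-- Embeddings as an induced subgraph: adjacency is both preserved and reflected.
record _↪_ (H : Graph m) (G : Graph n) : Set where
  private
    module H = Graph H
    module G = Graph G
  field
    to        : Fin m → Fin n
    injective : ∀ {x y} → to x ≡ to y → x ≡ y
    adjacent  : ∀ x y → (x H.~ y) ⇔ (to x G.~ to y)

↪-refl : ∀ {G : Graph n} → G ↪ G
↪-refl = record { to = id ; injective = id ; adjacent = λ _ _ → mk⇔ id id }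

↪-trans : ∀ {l} {F : Graph l} {H : Graph m} {G : Graph n} → F ↪ H → H ↪ G → F ↪ G
↪-trans f g = record
  { to        = g.to ∘ f.to
  ; injective = f.injective ∘ g.injective
  ; adjacent  = λ x y → g.adjacent (f.to x) (f.to y) ⇔-∘ f.adjacent x y
  }
  where
  module f = _↪_ f
  module g = _↪_ g

∖-↪ : ∀ {G : Graph (suc n)} i → (G ∖ i) ↪ G
∖-↪ i = record
  { to        = punchIn i
  ; injective = Fin.punchIn-injective i _ _
  ; adjacent  = λ _ _ → mk⇔ id id
  }

data Reduction (H : Graph (suc n)) (u : Fin (suc n)) : Set where
  isolated : (∀ w → ¬ Graph._~_ H u w) → Reduction H u
  leaf     : ∀ v → Graph._~_ H u v → (∀ w → Graph._~_ H u w → w ≡ v) → Reduction H u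
  twins    : ∀ v → u ≢ v → (∀ w → w ≢ u → w ≢ v → Graph._~_ H u w ⇔ Graph._~_ H v w) →
             Reduction H u

-- Quantifying over all nonempty induced subgraphs makes the property hereditary, so that it
-- survives the deletion of vertices in `failures-Path≤`.
Reducible : Graph n → Set₁
Reducible G = ∀ {m} {H : Graph (suc m)} → H ↪ G → ∃[ u ] Reduction H u

module _ {G : Graph n} {N : Pred (Fin n) 0ℓ} (N? : U.Decidable N) (v : Fin n)
         {H : Graph m} (e : H ↪ addVertex G N?) where
  private
    module G = Graph G
    module G⁺ = Graph (addVertex G N?)
    module H = Graph H
  open _↪_ e

  private
    identify : Fin (suc n) → Fin n
    identify zero    = v
    identify (suc x) = x

  -- The new vertex is replaced by `v`. The hypothesis says that, if the new vertex occurs in `H`,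
  -- then `v` does not and the two have the same neighbours among the rest; it is vacuous if the new
  -- vertex does not occur.
  retract : (∀ {x y w} → to x ≡ zero → to y ≡ suc w → w ≢ v × (N w ⇔ v G.~ w)) → H ↪ G
  retract new≈v = record
    { to        = identify ∘ to
    ; injective = λ {x} {y} → injective ∘ identify-injective x y
    ; adjacent  = λ x y → identify-adjacent x y ⇔-∘ adjacent x y
    }
    where
    identify-injective : ∀ x y → identify (to x) ≡ identify (to y) → to x ≡ to y
    identify-injective x y eq with to x in p | to y in q
    ... | zero  | zero  = refl
    ... | zero  | suc w = ⊥-elim (proj₁ (new≈v p q) (sym eq))
    ... | suc w | zero  = ⊥-elim (proj₁ (new≈v q p) eq)
    ... | suc _ | suc _ = cong suc eq

    identify-adjacent : ∀ x y → (to x G⁺.~ to y) ⇔ (identify (to x) G.~ identify (to y))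
    identify-adjacent x y with to x in p | to y in q
    ... | zero  | zero  = mk⇔ (λ ()) G.~-irr
    ... | zero  | suc w = proj₂ (new≈v p q)
    ... | suc w | zero  = mk⇔ (G.~-sym ∘ Equivalence.to N⇔) (Equivalence.from N⇔ ∘ G.~-sym)
      where N⇔ = proj₂ (new≈v q p)
    ... | suc _ | suc _ = mk⇔ id id

module _ {G : Graph n} (red : Reducible G) (v : Fin n) where

  -- If `H` contains both `v` and the new vertex, they are twins in `H`; otherwise `H` already
  -- embeds in `G`. Since `N` is compared with the neighbourhood of `v` only away from `v`, both
  -- kinds of twin are covered.
  reducible-twin : ∀ {N} (N? : U.Decidable N) → (∀ {w} → w ≢ v → N w ⇔ Graph._~_ G v w) →
    Reducible (addVertex G N?)
  reducible-twin N? N⇔ {H = H} e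
    with Fin.any? (λ x → to x Fin.≟ zero) | Fin.any? (λ x → to x Fin.≟ suc v)
    where open _↪_ e
  ... | no ¬new | _ = red (retract N? v e (λ p _ → ⊥-elim (¬new (_ , p))))
  ... | yes _ | no ¬v =
    red (retract N? v e (λ { _ q → let w≢v = λ { refl → ¬v (_ , q) } in w≢v , N⇔ w≢v }))
  ... | yes (x , p) | yes (y , q) =
    x , twins y (λ { refl → Fin.0≢1+n (trans (sym p) q) }) twin
    where
    open _↪_ e
    open Graph H

    twin : ∀ w → w ≢ x → w ≢ y → x ~ w ⇔ y ~ w
    twin w w≢x w≢y with to w in r | adjacent x w | adjacent y w
    ... | zero   | _   | _   = ⊥-elim (w≢x (injective (trans r (sym p))))
    ... | suc w′ | x~w | y~w rewrite p | q =
      ⇔-sym y~w ⇔-∘ (N⇔ w′≢v ⇔-∘ x~w)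
      where
      w′≢v : w′ ≢ v
      w′≢v refl = w≢y (injective (trans r (sym q)))

  private
    new-neighbour : ∀ {H : Graph m} (e : H ↪ addPendant G v) {x w} →
      _↪_.to e x ≡ zero → Graph._~_ H x w → _↪_.to e w ≡ suc v
    new-neighbour e {x} {w} p x~w
      with _↪_.to e x | p | _↪_.to e w | Equivalence.to (_↪_.adjacent e x w) x~w
    ... | _ | refl | suc _ | refl = refl

  -- If the new vertex occurs in `H`, it is a leaf or isolated according to whether `v` occurs too.
  -- Otherwise `H` embeds in `G`.
  reducible-pendant : Reducible (addPendant G v)
  reducible-pendant e
    with Fin.any? (λ x → to x Fin.≟ zero) | Fin.any? (λ x → to x Fin.≟ suc v)
    where open _↪_ e
  ... | no ¬new     | _           = red (retract (Fin._≟ v) v e (λ p _ → ⊥-elim (¬new (_ , p))))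
  ... | yes (x , p) | no ¬v       = x , isolated λ w x~w → ¬v (w , new-neighbour e p x~w)
  ... | yes (x , p) | yes (y , q) = x , leaf y (Equivalence.from (adjacent x y) x~y) λ w x~w →
      injective (trans (new-neighbour e p x~w) (sym q))
    where
    open _↪_ e
    x~y : Graph._~_ (addPendant G v) (to x) (to y)
    x~y rewrite p | q = refl

reducible : ∀ {G : Graph n} → Construction G → Reducible G
reducible single e = zero , isolated λ w z~w → Equivalence.to (_↪_.adjacent e zero w) z~w
reducible (pendant c v) = reducible-pendant (reducible c) v
reducible (falseTwin c v) = reducible-twin (reducible c) v _ λ _ → mk⇔ id id
reducible (trueTwin c v) = reducible-twin (reducible c) v _ λ w≢v →
  mk⇔ (λ { (inj₁ w≡v) → ⊥-elim (w≢v w≡v) ; (inj₂ v~w) → v~w }) inj₂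

≅⇒↪ : ∀ {G H : Graph n} → G ≅ H → H ↪ G
≅⇒↪ {G = G} {H} iso = record
  { to        = from
  ; injective = λ {x} {y} eq → trans (sym (strictlyInverseˡ x)) (trans (cong to eq) (strictlyInverseˡ y))
  ; adjacent  = λ x y → ⇔-sym $
      subst₂ (λ x′ y′ → (from x G.~ from y) ⇔ (x′ H.~ y′)) (strictlyInverseˡ x) (strictlyInverseˡ y)
        (adjacent (from x) (from y))
  }
  where
  module G = Graph G
  module H = Graph H
  open _≅_ iso
  open Inverse vertices using (strictlyInverseˡ)

-- Comparison with the path

reducible-↪ : ∀ {H : Graph m} {G : Graph n} → H ↪ G → Reducible G → Reducible H
reducible-↪ e red f = red (↪-trans f e)

-- Reducibility is applied to `G` itself. Isolated vertices and twins are settled by the binomial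
-- bounds; a leaf matches the recurrence of the path, with induction for both terms and `K` varying.
failures-Path≤ : ∀ n {G : Graph n} → Reducible G → (K? : U.Decidable K) →
  failures (Path n) K? ≤ failures G K?
failures-Path≤ zero red K? = ℕ.≤-trans (ℕ.≤-reflexive (failures-Path-0 K?)) z≤n
failures-Path≤ (suc n) {G} red K? with red ↪-refl
... | u , isolated iso = ℕ.≤-trans (failures-Path-1+ n K?) (isolated-failures G u iso K?)
-- A single vertex can only be isolated.
failures-Path≤ (suc zero) {G} red K? | zero , leaf zero u~v _ = ⊥-elim (Graph.~-irr G u~v)
failures-Path≤ (suc zero) red K? | zero , twins zero u≢v _ = ⊥-elim (u≢v refl)
failures-Path≤ (suc (suc n)) {G} red K? | u , twins v u≢v tw with around u v
... | here     = ⊥-elim (u≢v refl)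
... | there v′ = ℕ.≤-trans (failures-Path-2+ n K?) (twins-failures G u v′ K? tw)
failures-Path≤ (suc (suc n)) {G} red K? | u , leaf v u~v lf with around u v
... | here     = ⊥-elim (Graph.~-irr G u~v)
... | there v′ = begin
  failures (Path (2 + n)) K?
    ≤⟨ failures-Path-suc-suc n K? ⟩
  failures (Path (suc n)) K? + failures (Path n) (K? ∘ suc)
    ≤⟨ ℕ.+-mono-≤ (failures-Path≤ (suc n) red₁ K?) (failures-Path≤ n red₂ (K? ∘ suc)) ⟩
  failures (G ∖ u) K? + failures (G ∖ u ∖ v′) (K? ∘ suc)
    ≤⟨ leaf-failures G u v′ K? u~v lf ⟩
  failures G K? ∎
  where
  open ℕ.≤-Reasoning
  red₁ : Reducible (G ∖ u)
  red₁ = reducible-↪ (∖-↪ {G = G} u) red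
  red₂ : Reducible (G ∖ u ∖ v′)
  red₂ = reducible-↪ (∖-↪ {G = G ∖ u} v′) red₁

z≤z-Path : ∀ {G : Graph n} → Reducible G → ∀ k → z G k ≤ z (Path n) k
z≤z-Path {n} {G} red k = ℕ.+-cancelʳ-≤ (failures G (ℕ._≟ k)) _ _ $ begin
  z G k + failures G (ℕ._≟ k)                  ≡⟨ z+failures G k ⟩
  binomial n (ℕ._≟ k)                          ≡⟨ z+failures (Path n) k ⟨
  z (Path n) k + failures (Path n) (ℕ._≟ k)    ≤⟨ ℕ.+-monoʳ-≤ (z (Path n) k) (failures-Path≤ n red (ℕ._≟ k)) ⟩
  z (Path n) k + failures G (ℕ._≟ k)           ∎
  where open ℕ.≤-Reasoning

applyUpTo-⪯ : ∀ {f g : ℕ → ℕ} → (∀ i → f i ≤ g i) → ∀ n → applyUpTo f n ⪯ applyUpTo g n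
-- Past the end of the list both coefficients are 0.
applyUpTo-⪯ f≤g zero    k       = z≤n
applyUpTo-⪯ f≤g (suc n) zero    = f≤g 0
applyUpTo-⪯ f≤g (suc n) (suc k) = applyUpTo-⪯ (f≤g ∘ suc) n k

theorem1 : ∀ {n : ℕ} (G : Graph n) → DistanceHereditary G →
    PathExtremal G × 𝒵 G ⪯ 𝒵 (Path n)
theorem1 {n} G (G₀ , construction , G₀≅G) = (λ k _ → z≤ k) , λ
  { zero    → z≤n
  ; (suc k) → applyUpTo-⪯ (z≤ ∘ suc) n k
  }
  where
  z≤ : ∀ k → z G k ≤ z (Path n) k
  -- Reducibility is established for the constructed graph `G₀` and carried over to its isomorphic
  -- copy `G`.
  z≤ = z≤z-Path (reducible-↪ (≅⇒↪ G₀≅G) (reducible construction))
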